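{- For all positive integers $k$ and $c$, the van der Waerden number $w(k;c)$ for $c$-colored $k$-term arithmetic progressions satisfies \[ w(k;c) \;\geq\; \frac{c^{k-3}}{k}\cdot\frac{k-1}{k} \;=\; \frac{c^{k-3}}{k}\,(1-o(1)), \] where $o(1)$ denotes a quantity tending to $0$ as $k\to\infty$ (and $c^{k-3}$ is the real power, so it may be less than $1$ when $k<3$).
   Context: A $k$-term arithmetic progression with gap $d$ is a set of the form $\{a, a+d, \ldots, a+(k-1)d\}$ with $a,d$ positive integers. A string of length $n$ over an alphabet $\Sigma$ with $|\Sigma|=c$ is identified with a coloring $\chi\colon\{1,\ldots,n\}\to\Sigma$ with $c$ colors; a progression contained in $\{1,\ldots,n\}$ is monochromatic if $\chi$ restricted to it is constant. The van der Waerden number $w(k;c)$ is the smallest positive integer $n$ such that every string of length $n$ over an alphabet of size $c$ (equivalently, every coloring of $\{1,\ldots,n\}$ with $c$ colors) contains a monochromatic $k$-term arithmetic progression. It exists by van der Waerden's theorem. -}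

module Defs where

open import Data.Fin using (Fin; toℕ)
open import Data.Integer as ℤ using (ℤ; +_; -[1+_])
open import Data.Nat using (ℕ; suc; _+_; _*_; _^_; _≤_; _<_; NonZero)
open import Data.Nat.Properties using (m^n≢0)
open import Data.Product using (∃-syntax; _×_)
open import Data.Rational as ℚ using (ℚ; 0ℚ)
open import Level using (0ℓ)
open import Relation.Binary.PropositionalEquality using (_≡_)
open import Relation.Unary using (Pred; _∈_; _⊆_)

[1⋯_] : ℕ → Pred ℕ 0ℓ
[1⋯ n ] x = 1 ≤ x × x ≤ n

Progression : (k a d : ℕ) → Pred ℕ 0ℓ
Progression k a d x = ∃[ j ] (j < k × x ≡ a + j * d)

Coloring : (n c : ℕ) → Set
Coloring n c = Fin n → Fin c

-- The index i : Fin n stands for the element 1 + toℕ i of {1, …, n}.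
position : ∀ {n} → Fin n → ℕ
position i = suc (toℕ i)

Monochromatic : ∀ {n c} → Coloring n c → Pred ℕ 0ℓ → Set
Monochromatic χ P = ∀ i j → position i ∈ P → position j ∈ P → χ i ≡ χ j

ContainsMonochromaticAP : ∀ {n c} → ℕ → Coloring n c → Set
ContainsMonochromaticAP {n} k χ =
  ∃[ a ] ∃[ d ] (1 ≤ a × 1 ≤ d
    × Progression k a d ⊆ [1⋯ n ]
    × Monochromatic χ (Progression k a d))

EveryColoringContainsAP : (k c n : ℕ) → Set
EveryColoringContainsAP k c n = (χ : Coloring n c) → ContainsMonochromaticAP k χ

-- w(k;c) is given by its graph: its existence is van der Waerden's theorem,
-- its uniqueness is immediate from minimality.
record IsVanDerWaerdenNumber (k c w : ℕ) : Set where
  field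
    positive : 1 ≤ w
    forces   : EveryColoringContainsAP k c w
    least    : ∀ n → 1 ≤ n → EveryColoringContainsAP k c n → w ≤ n

infixr 8 _^ℤ_

_^ℤ_ : (c : ℕ) .{{_ : NonZero c}} → ℤ → ℚ
c ^ℤ (+ m)    = (+ (c ^ m)) ℚ./ 1
c ^ℤ -[1+ m ] = ((+ 1) ℚ./ (c ^ suc m)) {{m^n≢0 c (suc m)}}

ℕ→ℚ : ℕ → ℚ
ℕ→ℚ n = (+ n) ℚ./ 1

TendsToZero : (ℕ → ℚ) → Set
TendsToZero ε = ∀ δ → 0ℚ ℚ.< δ → ∃[ N ] (∀ k → N ≤ k → ℚ.∣ ε k ∣ ℚ.< δ)

-- c^(k-3) / k
mainTerm : (k c : ℕ) .{{_ : NonZero k}} .{{_ : NonZero c}} → ℚ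
mainTerm k c = (c ^ℤ ((+ k) ℤ.- (+ 3))) ℚ.* ((+ 1) ℚ./ k)

{-# OPTIONS --safe #-}

-- Rosenfeld's counting argument. Let G(L) be the number of colorings without a monochromatic
-- progression inside L, a set of positions. Adding a position x to L destroys only colorings
-- for which some progression e through x is monochromatic while L ∖ e is good; their number is
-- G(L ∖ e) / c^(k-1), because the colors on e are independent of goodness on L ∖ e. Inductively
-- G(L ∖ e) ≤ (2k/(2k-1))^k G(L) ≤ 2 G(L), so if every position lies on at most Δ progressions
-- and 4kΔ ≤ c^(k-1), then G(L ∪ {x}) ≥ (1 - 1/(2k)) G(L), and a coloring good everywhere exists.
-- For {1, …, n} one can take Δ = k ⌊n/(k-1)⌋.
module Submission where

open import Defs
open import Data.Bool using (if_then_else_)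
open import Data.Fin as Fin using (Fin; zero; suc; toℕ)
import Data.Fin.Properties as Fin
open import Data.Integer as ℤ using (+_; -[1+_])
import Data.Integer.Properties as ℤ
open import Data.List using (List; []; _∷_; length; map; filter; allFin; applyUpTo; upTo;
  cartesianProduct; cartesianProductWith)
open import Data.List.Membership.Propositional using (_∈_; find)
open import Data.List.Membership.Propositional.Properties
open import Data.List.Properties
  using (filter-notAll; length-filter; length-map; length-++; length-upTo; length-applyUpTo)
open import Data.List.Relation.Unary.All as All using (All; []; _∷_)
open import Data.List.Relation.Unary.All.Properties.Core using (¬All⇒Any¬)
open import Data.List.Relation.Unary.AllPairs using ([]; _∷_)
open import Data.List.Relation.Unary.Any as Any using (here; there)
open import Data.List.Relation.Unary.Unique.Propositional using (Unique)
import Data.List.Relation.Unary.Unique.Propositional.Properties as Unique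
open import Data.Nat using (ℕ; zero; suc; _+_; _*_; _∸_; _^_; _/_; _≤_; _<_; _≤?_; _<?_; z≤n; s≤s;
  NonZero; >-nonZero)
open import Data.Nat.DivMod using (_mod_; m%n<n; m<n⇒m%n≡m; m*n/n≡m; m/n*n≤m; /-monoˡ-≤)
open import Data.Nat.ListAction renaming (sum to sumᴸ) using ()
open import Data.Nat.Properties
open import Algebra.Properties.Semiring.Sum +-*-semiring
  using (sum; sum-cong-≗; ∑-distrib-+; ∑-comm; *-distribˡ-sum; *-distribʳ-sum)
open import Data.Nat.Tactic.RingSolver using (solve-∀)
open import Data.Product using (∃-syntax; _×_; _,_; proj₁; proj₂)
open import Data.Rational as ℚ using (ℚ; 0ℚ; 1ℚ; mkℚ; toℚᵘ)
import Data.Rational.Properties as ℚ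
open import Data.Rational.Unnormalised as ℚᵘ using (mkℚᵘ; *≤*; *<*; *≡*)
import Data.Rational.Unnormalised.Properties as ℚᵘ
open import Data.Vec using (Vec; []; _∷_; lookup; _[_]≔_)
open import Data.Vec.Properties using (lookup∘update; lookup∘update′)
open import Function using (_∘_)
open import Relation.Binary.PropositionalEquality
  using (_≡_; _≢_; refl; sym; trans; cong; cong₂; subst; subst₂; module ≡-Reasoning)
open import Relation.Nullary using (¬_; Dec; yes; no; does; ¬?; _×-dec_; contradiction)
open import Relation.Nullary.Decidable using (decidable-stable)

-- Indicators and finite sums.

indicator : ∀ {A : Set} → Dec A → ℕ
indicator a? = if does a? then 1 else 0

indicator-mono : ∀ {A B : Set} (a? : Dec A) (b? : Dec B) → (A → B) → indicator a? ≤ indicator b?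
indicator-mono (no _)  b?      f = z≤n
indicator-mono (yes a) (yes _) f = ≤-refl
indicator-mono (yes a) (no ¬b) f = contradiction (f a) ¬b

indicator-true : ∀ {A : Set} (a? : Dec A) → A → indicator a? ≡ 1
indicator-true (yes _) _ = refl
indicator-true (no ¬a) a = contradiction a ¬a

indicator-false : ∀ {A : Set} (a? : Dec A) → ¬ A → indicator a? ≡ 0
indicator-false (yes a) ¬a = contradiction a ¬a
indicator-false (no _)  _  = refl

indicator-cong : ∀ {A B : Set} (a? : Dec A) (b? : Dec B) → (A → B) → (B → A) →
  indicator a? ≡ indicator b?
indicator-cong a? b? f g = ≤-antisym (indicator-mono a? b? f) (indicator-mono b? a? g)

indicator-× : ∀ {A B : Set} (a? : Dec A) (b? : Dec B) →
  indicator (a? ×-dec b?) ≡ indicator a? * indicator b?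
indicator-× (yes _) b? = sym (+-identityʳ _)
indicator-× (no _)  b? = refl

sum-const : ∀ c x → sum {c} (λ _ → x) ≡ c * x
sum-const zero    x = refl
sum-const (suc c) x = cong (λ t → x + t) (sum-const c x)

sum-mono : ∀ {c} (f g : Fin c → ℕ) → (∀ a → f a ≤ g a) → sum f ≤ sum g
sum-mono {zero}  f g f≤g = z≤n
sum-mono {suc c} f g f≤g = +-mono-≤ (f≤g zero) (sum-mono (f ∘ suc) (g ∘ suc) (f≤g ∘ suc))

sum-indicator-≟ : ∀ {c} (b : Fin c) → sum (λ a → indicator (a Fin.≟ b)) ≡ 1
sum-indicator-≟ {suc c} zero    = cong suc (trans (sum-const c 0) (*-zeroʳ c))
sum-indicator-≟ {suc c} (suc b) = sum-indicator-≟ b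

-- Sums over all colorings.

module _ {c : ℕ} where

  total : ∀ n → (Vec (Fin c) n → ℕ) → ℕ
  total zero    f = f []
  total (suc n) f = sum (λ a → total n (λ χ → f (a ∷ χ)))

  total-mono : ∀ n {f g} → (∀ χ → f χ ≤ g χ) → total n f ≤ total n g
  total-mono zero    f≤g = f≤g []
  total-mono (suc n) f≤g = sum-mono _ _ (λ a → total-mono n (f≤g ∘ (a ∷_)))

  total-cong : ∀ n {f g} → (∀ χ → f χ ≡ g χ) → total n f ≡ total n g
  total-cong zero    f≡g = f≡g []
  total-cong (suc n) f≡g = sum-cong-≗ (λ a → total-cong n (f≡g ∘ (a ∷_)))

  total-+ : ∀ n f g → total n (λ χ → f χ + g χ) ≡ total n f + total n g
  total-+ zero    f g = refl
  total-+ (suc n) f g = trans (sum-cong-≗ {c} (λ a → total-+ n _ _)) (∑-distrib-+ {c} _ _)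

  total-const : ∀ n x → total n (λ _ → x) ≡ c ^ n * x
  total-const zero    x = sym (+-identityʳ x)
  total-const (suc n) x = trans (sum-const c _)
    (trans (cong (c *_) (total-const n x)) (sym (*-assoc c (c ^ n) x)))

  total-sum : ∀ n {m} (f : Fin m → Vec (Fin c) n → ℕ) →
    total n (λ χ → sum (λ a → f a χ)) ≡ sum (λ a → total n (f a))
  total-sum zero    f = refl
  total-sum (suc n) {m} f = trans
    (sum-cong-≗ {c} (λ b → total-sum n (λ a χ → f a (b ∷ χ)))) (∑-comm {c} {m} _)

  -- Every coloring arises `c` times by recoloring `y`: the new color is forced, the overwritten one
  -- is free.
  total-resample : ∀ {n} (y : Fin n) f →
    total n (λ χ → sum (λ a → f (χ [ y ]≔ a))) ≡ c * total n f
  total-resample {suc n} zero f = trans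
    (sum-cong-≗ {c} (λ b → total-sum n (λ a χ → f (a ∷ χ)))) (sum-const c _)
  total-resample {suc n} (suc y) f = trans
    (sum-cong-≗ {c} (λ b → total-resample y _)) (sym (*-distribˡ-sum {c} c _))

  Ignores : ∀ {n} → Fin n → (Vec (Fin c) n → ℕ) → Set
  Ignores z Q = ∀ χ a → Q (χ [ z ]≔ a) ≡ Q χ

  -- Resample the color of `z`: neither `Q` nor the color of `y` changes, and exactly one of the `c`
  -- colors matches `y`.
  total-same-color : ∀ {n} {y z : Fin n} Q → y ≢ z → Ignores z Q →
    c * total n (λ χ → indicator (lookup χ z Fin.≟ lookup χ y) * Q χ) ≡ total n Q
  total-same-color {n} {y} {z} Q y≢z ignores = begin
    c * total n (λ χ → indicator (lookup χ z Fin.≟ lookup χ y) * Q χ)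
      ≡⟨ total-resample z _ ⟨
    total n (λ χ → sum {c} (λ a →
      indicator (lookup (χ [ z ]≔ a) z Fin.≟ lookup (χ [ z ]≔ a) y) * Q (χ [ z ]≔ a)))
      ≡⟨ total-cong n (λ χ → sum-cong-≗ {c} (λ a → cong₂ _*_
           (cong₂ (λ u v → indicator (u Fin.≟ v)) (lookup∘update z χ a) (lookup∘update′ y≢z χ a))
           (ignores χ a))) ⟩
    total n (λ χ → sum {c} (λ a → indicator (a Fin.≟ lookup χ y) * Q χ))
      ≡⟨ total-cong n (λ χ → trans (sym (*-distribʳ-sum {c} (Q χ) _))
           (trans (cong (_* Q χ) (sum-indicator-≟ (lookup χ y))) (+-identityʳ _))) ⟩
    total n Q ∎
    where open ≡-Reasoning

-- Hyperedges, and the independence of agreement on an edge from outside events.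

Edge : ℕ → Set
Edge n = Fin n × List (Fin n)

vertices : ∀ {n} → Edge n → List (Fin n)
vertices (y , ys) = y ∷ ys

module _ {n c : ℕ} where

  -- Comparison with one distinguished vertex costs a factor `c` for each other vertex, which yields
  -- the exponent k - 1 for an edge of k vertices.
  Agree : Edge n → Vec (Fin c) n → Set
  Agree (y , ys) χ = All (λ z → lookup χ z ≡ lookup χ y) ys

  agree? : ∀ e χ → Dec (Agree e χ)
  agree? (y , ys) χ = All.all? (λ z → lookup χ z Fin.≟ lookup χ y) ys

  total-agree : ∀ y ys Q → Unique (y ∷ ys) → (∀ {z} → z ∈ ys → Ignores z Q) →
    c ^ length ys * total n (λ χ → indicator (agree? (y , ys) χ) * Q χ) ≡ total n Q
  total-agree y []       Q _ ignores =
    trans (+-identityʳ _) (total-cong n (λ χ → +-identityʳ _))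
  total-agree y (z ∷ zs) Q ((y≢z ∷ y∉zs) ∷ (z∉zs ∷ uniq)) ignores = begin
    c ^ suc (length zs) * total n (λ χ → indicator (agree? (y , z ∷ zs) χ) * Q χ)
      ≡⟨ *-assoc c (c ^ length zs) _ ⟩
    c * (c ^ length zs * total n (λ χ → indicator (agree? (y , z ∷ zs) χ) * Q χ))
      ≡⟨ cong (λ t → c * (c ^ length zs * t)) (total-cong n (λ χ → trans
           (cong (_* Q χ) (trans (indicator-× (same? χ) (agree? (y , zs) χ))
             (*-comm (indicator (same? χ)) _)))
           (*-assoc (indicator (agree? (y , zs) χ)) _ _))) ⟩
    c * (c ^ length zs * total n (λ χ → indicator (agree? (y , zs) χ) * Q′ χ))
      ≡⟨ cong (c *_) (total-agree y zs Q′ (y∉zs ∷ uniq) ignores′) ⟩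
    c * total n Q′
      ≡⟨ total-same-color Q y≢z (ignores (here refl)) ⟩
    total n Q ∎
    where
    open ≡-Reasoning
    same? : ∀ χ → Dec (lookup χ z ≡ lookup χ y)
    same? χ = lookup χ z Fin.≟ lookup χ y
    -- The comparison of `z` with `y` is absorbed into the weight, which still ignores the remaining
    -- vertices because they differ from both.
    Q′ : Vec (Fin c) n → ℕ
    Q′ χ = indicator (same? χ) * Q χ
    ignores′ : ∀ {v} → v ∈ zs → Ignores v Q′
    ignores′ v∈zs χ a = cong₂ _*_
      (cong₂ (λ s t → indicator (s Fin.≟ t))
        (lookup∘update′ (All.lookup z∉zs v∈zs) χ a)
        (lookup∘update′ (All.lookup y∉zs v∈zs) χ a))
      (ignores (there v∈zs) χ a)

-- Deleting vertices from a set of positions.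

module _ {n : ℕ} where

  remove : Fin n → List (Fin n) → List (Fin n)
  remove y = filter (λ v → ¬? (v Fin.≟ y))

  infixl 6 _∖_
  _∖_ : List (Fin n) → List (Fin n) → List (Fin n)
  L ∖ []       = L
  L ∖ (y ∷ ys) = remove y L ∖ ys

  ∈-∖⁻ : ∀ {v} L ys → v ∈ L ∖ ys → v ∈ L × ¬ v ∈ ys
  ∈-∖⁻ L []       v∈ = v∈ , λ ()
  ∈-∖⁻ L (y ∷ ys) v∈ with ∈-∖⁻ (remove y L) ys v∈
  ... | v∈′ , v∉ys with ∈-filter⁻ (λ v → ¬? (v Fin.≟ y)) {xs = L} v∈′
  ...   | v∈L , v≢y = v∈L , λ { (here v≡y) → v≢y v≡y ; (there v∈ys) → v∉ys v∈ys }

  length-remove : ∀ {y} {L : List (Fin n)} → y ∈ L → length (remove y L) < length L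
  length-remove {y} {L} y∈L = filter-notAll _ L (Any.map (λ y≡v ¬v≡y → ¬v≡y (sym y≡v)) y∈L)

-- Bernoulli's inequality and the ratio bound.

-- With q = p + 1, this is (1 - 1/q)^j ≥ 1 - j/q cleared of denominators and subtraction.
bernoulli : ∀ p j → suc p ^ j * suc p ≤ suc p * p ^ j + j * suc p ^ j
bernoulli p zero    = ≤-reflexive (lemma p)
  where
  lemma : ∀ p → 1 * suc p ≡ suc p * 1 + 0
  lemma = solve-∀
bernoulli p (suc j) = begin
  q * q ^ j * q                                   ≡⟨ *-assoc q (q ^ j) q ⟩
  q * (q ^ j * q)                                 ≤⟨ *-monoʳ-≤ q (bernoulli p j) ⟩
  q * (q * p ^ j + j * q ^ j)                     ≡⟨ lemma p j (p ^ j) (q ^ j) ⟩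
  q * (p * p ^ j) + (q * p ^ j + j * (q * q ^ j)) ≤⟨ +-monoʳ-≤ (q * (p * p ^ j))
    (+-monoˡ-≤ (j * (q * q ^ j)) (*-monoʳ-≤ q (^-monoˡ-≤ j (n≤1+n p)))) ⟩
  q * (p * p ^ j) + suc j * (q * q ^ j)           ∎
  where
  open ≤-Reasoning
  q = suc p
  lemma : ∀ p j x y → suc p * (suc p * x + j * y) ≡
    suc p * (p * x) + (suc p * x + j * (suc p * y))
  lemma = solve-∀

-- Bernoulli with q = 2k and j = k, where k is `suc K`, gives (1 - 1/(2k))^k ≥ 1/2.
power-ratio-≤2 : ∀ K → (suc K + suc K) ^ suc K ≤ 2 * (K + suc K) ^ suc K
power-ratio-≤2 K = *-cancelˡ-≤ (suc K) (+-cancelʳ-≤ (suc K * Q) _ _ (begin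
  suc K * Q + suc K * Q               ≡⟨ lemma₁ (suc K) Q ⟩
  Q * (suc K + suc K)                 ≤⟨ bernoulli (K + suc K) (suc K) ⟩
  (suc K + suc K) * P + suc K * Q     ≡⟨ cong (_+ suc K * Q) (lemma₂ (suc K) P) ⟩
  suc K * (2 * P) + suc K * Q         ∎))
  where
  open ≤-Reasoning
  Q = (suc K + suc K) ^ suc K
  P = (K + suc K) ^ suc K
  lemma₁ : ∀ k x → k * x + k * x ≡ x * (k + k)
  lemma₁ = solve-∀
  lemma₂ : ∀ k x → (k + k) * x ≡ k * (2 * x)
  lemma₂ = solve-∀

-- Counting good colorings of a sparse uniform hypergraph.

∈⇒≤sum-map : ∀ {A : Set} (f : A → ℕ) {x xs} → x ∈ xs → f x ≤ sumᴸ (map f xs)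
∈⇒≤sum-map f (here refl)         = m≤m+n _ _
∈⇒≤sum-map f (there {y} x∈xs) = ≤-trans (∈⇒≤sum-map f x∈xs) (m≤n+m _ (f y))

-- Edges have k = `suc K` vertices. The list `through x` may overshoot the edges containing `x`,
-- since it serves only as the range of a union bound.
module _
  {n c K Δ : ℕ}
  (edges : List (Edge n))
  (through : Fin n → List (Edge n))
  (through-complete : ∀ {x e} → e ∈ edges → x ∈ vertices e → e ∈ through x)
  (simple : ∀ {x e} → e ∈ through x → Unique (vertices e))
  (uniform : ∀ {x e} → e ∈ through x → length (proj₂ e) ≡ K)
  (degree : ∀ x → length (through x) ≤ Δ)
  (sparse : 4 * suc K * Δ ≤ c ^ K)
  .{{_ : NonZero c}}
  where

  open import Data.List.Membership.DecPropositional (Fin._≟_ {n}) using (_∈?_)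

  BadIn : List (Fin n) → Vec (Fin c) n → Edge n → Set
  BadIn L χ e = All (_∈ L) (vertices e) × Agree e χ

  badIn? : ∀ L χ e → Dec (BadIn L χ e)
  badIn? L χ e = All.all? (_∈? L) (vertices e) ×-dec agree? e χ

  Good : List (Fin n) → Vec (Fin c) n → Set
  Good L χ = All (λ e → ¬ BadIn L χ e) edges

  good? : ∀ L χ → Dec (Good L χ)
  good? L χ = All.all? (λ e → ¬? (badIn? L χ e)) edges

  goodCount : List (Fin n) → ℕ
  goodCount L = total n (λ χ → indicator (good? L χ))

  Good-antitone : ∀ {L L′} χ → (∀ {v} → v ∈ L′ → v ∈ L) → Good L χ → Good L′ χ
  Good-antitone χ L′⊆L = All.map (λ ¬bad (in′ , agree) → ¬bad (All.map L′⊆L in′ , agree))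

  goodCount-antitone : ∀ {L L′} → (∀ {v} → v ∈ L′ → v ∈ L) → goodCount L ≤ goodCount L′
  goodCount-antitone {L} {L′} L′⊆L =
    total-mono n (λ χ → indicator-mono (good? L χ) (good? L′ χ) (Good-antitone χ L′⊆L))

  -- Supplies the `Ignores` hypothesis of `total-agree`: once the vertices of an edge are deleted
  -- from `L`, recoloring them cannot affect goodness.
  Good-local : ∀ L χ χ′ → (∀ {z} → z ∈ L → lookup χ z ≡ lookup χ′ z) → Good L χ → Good L χ′
  Good-local L χ χ′ same = All.map λ { ¬bad (y∈L ∷ ys⊆L , agree) →
    ¬bad (y∈L ∷ ys⊆L , All.zipWith
      (λ (z∈L , z≡y) → trans (same z∈L) (trans z≡y (sym (same y∈L)))) (ys⊆L , agree)) }

  -- Goodness is required only away from `e`. This overcounts the colorings destroyed by `e`, but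
  -- makes the two factors independent.
  bad : List (Fin n) → Edge n → Vec (Fin c) n → ℕ
  bad L e χ = indicator (agree? e χ) * indicator (good? (L ∖ vertices e) χ)

  -- If adding `x` destroys goodness, some bad edge is responsible; it contains `x`, since otherwise
  -- it would already lie in `L`. The sum over `through x` then counts it.
  good-extension : ∀ x L χ → indicator (good? L χ) ≤
    indicator (good? (x ∷ L) χ) + sumᴸ (map (λ e → bad L e χ) (through x))
  good-extension x L χ with good? (x ∷ L) χ | good? L χ
  ... | yes _    | yes _ = s≤s z≤n
  ... | _        | no _  = z≤n
  ... | no ¬good | yes good with find (¬All⇒Any¬ (λ e → ¬? (badIn? (x ∷ L) χ e)) edges ¬good)
  ...   | e , e∈ , ¬¬bad with decidable-stable (badIn? (x ∷ L) χ e) ¬¬bad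
  ...     | in′ , agree = begin
    1         ≡⟨ cong₂ _*_ (indicator-true (agree? e χ) agree)
                   (indicator-true (good? (L ∖ vertices e) χ)
                     (Good-antitone χ (proj₁ ∘ ∈-∖⁻ L (vertices e)) good)) ⟨
    bad L e χ ≤⟨ ∈⇒≤sum-map (λ e → bad L e χ) (through-complete e∈ x∈e) ⟩
    _         ∎
    where
    open ≤-Reasoning
    inL : ¬ x ∈ vertices e → ∀ {v} → v ∈ vertices e → v ∈ x ∷ L → v ∈ L
    inL x∉e v∈e (here refl) = contradiction v∈e x∉e
    inL x∉e v∈e (there v∈L) = v∈L
    x∈e : x ∈ vertices e
    x∈e = decidable-stable (x ∈? vertices e) λ x∉e →
      All.lookup good e∈ (All.tabulate (λ v∈e → inL x∉e v∈e (All.lookup in′ v∈e)) , agree)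

  bad-count : ∀ {x e} L → e ∈ through x →
    c ^ K * total n (bad L e) ≡ goodCount (L ∖ vertices e)
  bad-count {x} {e@(y , ys)} L e∈ with refl ← uniform e∈ =
    total-agree y ys _ (simple e∈) λ {z} z∈ys χ a →
      indicator-cong (good? (L ∖ vertices e) (χ [ z ]≔ a)) (good? (L ∖ vertices e) χ)
        (Good-local _ (χ [ z ]≔ a) χ (unchanged z∈ys χ a))
        (Good-local _ χ (χ [ z ]≔ a) (sym ∘ unchanged z∈ys χ a))
    where
    unchanged : ∀ {z} → z ∈ ys → ∀ χ a {v} → v ∈ L ∖ vertices e →
      lookup (χ [ z ]≔ a) v ≡ lookup χ v
    unchanged z∈ys χ a v∈ = lookup∘update′
      (λ { refl → proj₂ (∈-∖⁻ L (vertices e) v∈) (there z∈ys) }) χ a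

  2k 2k-1 : ℕ
  2k = suc K + suc K
  2k-1 = K + suc K

  -- The growth ratio 1 - 1/(2k) without division. The length bound makes it an induction hypothesis
  -- for shorter lists.
  Extends : ℕ → Set
  Extends m = ∀ L → length L < m → ∀ x → 2k-1 * goodCount L ≤ 2k * goodCount (x ∷ L)

  goodCount-remove : ∀ {m} → Extends m → ∀ L → length L ≤ m → ∀ y →
    2k-1 * goodCount (remove y L) ≤ 2k * goodCount L
  goodCount-remove ext L |L|≤m y with y ∈? L
  -- Deletion strictly shortens `L`, so the hypothesis applies even when `L` has length exactly `m`.
  ... | yes y∈L = ≤-trans (ext (remove y L) (≤-trans (length-remove y∈L) |L|≤m) y)
    (*-monoʳ-≤ 2k (goodCount-antitone L⊆))
    where
    L⊆ : ∀ {v} → v ∈ L → v ∈ y ∷ remove y L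
    L⊆ {v} v∈L with v Fin.≟ y
    ... | yes v≡y = here v≡y
    ... | no  v≢y = there (∈-filter⁺ (λ v → ¬? (v Fin.≟ y)) v∈L v≢y)
  ... | no y∉L = *-mono-≤ (n≤1+n 2k-1) (goodCount-antitone
    (λ {v} v∈L → ∈-filter⁺ (λ v → ¬? (v Fin.≟ y)) v∈L (λ { refl → y∉L v∈L })))

  goodCount-∖ : ∀ {m} → Extends m → ∀ L → length L ≤ m → ∀ ys →
    2k-1 ^ length ys * goodCount (L ∖ ys) ≤ 2k ^ length ys * goodCount L
  goodCount-∖ ext L |L|≤m []       = ≤-refl
  goodCount-∖ ext L |L|≤m (y ∷ ys) = begin
    2k-1 * 2k-1 ^ l * goodCount (remove y L ∖ ys)   ≡⟨ *-assoc 2k-1 (2k-1 ^ l) _ ⟩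
    2k-1 * (2k-1 ^ l * goodCount (remove y L ∖ ys)) ≤⟨ *-monoʳ-≤ 2k-1 (goodCount-∖ ext (remove y L)
                                                   (≤-trans (length-filter _ L) |L|≤m) ys) ⟩
    2k-1 * (2k ^ l * goodCount (remove y L))        ≡⟨ swap 2k-1 (2k ^ l) _ ⟩
    2k ^ l * (2k-1 * goodCount (remove y L))        ≤⟨ *-monoʳ-≤ (2k ^ l) (goodCount-remove ext L |L|≤m y) ⟩
    2k ^ l * (2k * goodCount L)                     ≡⟨ swap (2k ^ l) 2k _ ⟩
    2k * (2k ^ l * goodCount L)                     ≡⟨ *-assoc 2k (2k ^ l) _ ⟨
    2k * 2k ^ l * goodCount L                       ∎
    where
    open ≤-Reasoning
    l = length ys
    swap : ∀ x y z → x * (y * z) ≡ y * (x * z)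
    swap = solve-∀

  -- Deleting the k vertices of an edge one by one costs k ratios 2k/(2k-1), whose product is at
  -- most 2.
  goodCount-∖-edge : ∀ {m} → Extends m → ∀ L → length L ≤ m → ∀ {x e} → e ∈ through x →
    goodCount (L ∖ vertices e) ≤ 2 * goodCount L
  goodCount-∖-edge ext L |L|≤m {x} {e} e∈ with refl ← uniform e∈ =
    *-cancelˡ-≤ (2k-1 ^ suc K) {{m^n≢0 2k-1 (suc K) {{2k-1≢0}}}} (begin
      2k-1 ^ suc K * goodCount (L ∖ vertices e) ≤⟨ goodCount-∖ ext L |L|≤m (vertices e) ⟩
      2k ^ suc K * goodCount L                  ≤⟨ *-monoˡ-≤ _ (power-ratio-≤2 K) ⟩
      2 * 2k-1 ^ suc K * goodCount L            ≡⟨ lemma (2k-1 ^ suc K) (goodCount L) ⟩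
      2k-1 ^ suc K * (2 * goodCount L)          ∎)
    where
    open ≤-Reasoning
    2k-1≢0 : NonZero 2k-1
    2k-1≢0 = >-nonZero (≤-trans (s≤s z≤n) (m≤n+m (suc K) K))
    lemma : ∀ x y → 2 * x * y ≡ x * (2 * y)
    lemma = solve-∀

  total-sum-map : ∀ {A : Set} (f : A → Vec (Fin c) n → ℕ) M xs →
    (∀ {x} → x ∈ xs → c ^ K * total n (f x) ≤ M) →
    c ^ K * total n (λ χ → sumᴸ (map (λ x → f x χ) xs)) ≤ length xs * M
  total-sum-map f M []       bound =
    ≤-reflexive (trans (cong (c ^ K *_) (trans (total-const n 0) (*-zeroʳ (c ^ n)))) (*-zeroʳ (c ^ K)))
  total-sum-map f M (x ∷ xs) bound = begin
    c ^ K * total n (λ χ → f x χ + rest χ)       ≡⟨ cong (c ^ K *_) (total-+ n _ _) ⟩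
    c ^ K * (total n (f x) + total n rest)       ≡⟨ *-distribˡ-+ (c ^ K) _ _ ⟩
    c ^ K * total n (f x) + c ^ K * total n rest ≤⟨ +-mono-≤ (bound (here refl))
                                                         (total-sum-map f M xs (bound ∘ there)) ⟩
    M + length xs * M                            ∎
    where
    open ≤-Reasoning
    rest : Vec (Fin c) n → ℕ
    rest χ = sumᴸ (map (λ x → f x χ) xs)

  extends : ∀ m → Extends m
  -- Adding `G` to both sides avoids subtraction and leaves 2k `B` ≤ `G` to be shown, where `B`
  -- bounds the loss caused by `x`.
  extends (suc m) L (s≤s |L|≤m) x = +-cancelʳ-≤ G _ _ (begin
    2k-1 * G + G     ≡⟨ +-comm _ G ⟩
    2k * G           ≤⟨ *-monoʳ-≤ 2k (≤-trans (total-mono n (good-extension x L))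
                                 (≤-reflexive (total-+ n _ _))) ⟩
    2k * (G′ + B)    ≡⟨ *-distribˡ-+ 2k G′ B ⟩
    2k * G′ + 2k * B ≤⟨ +-monoʳ-≤ (2k * G′) 2kB≤G ⟩
    2k * G′ + G      ∎)
    where
    open ≤-Reasoning
    G G′ B : ℕ
    G = goodCount L
    G′ = goodCount (x ∷ L)
    B = total n (λ χ → sumᴸ (map (λ e → bad L e χ) (through x)))
    lemma₁ : ∀ x y z → y * (x * z) ≡ x * (y * z)
    lemma₁ = solve-∀
    lemma₂ : ∀ k d g → (k + k) * (d * (2 * g)) ≡ 4 * k * d * g
    lemma₂ = solve-∀
    2kB≤G : 2k * B ≤ G
    -- Each of the at most `Δ` edges contributes at most 2 `G` after scaling by `c ^ K`, so the
    -- total is 4k`Δ` `G`, which is where `sparse` enters.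
    2kB≤G = *-cancelˡ-≤ (c ^ K) {{m^n≢0 c K}} (begin
      c ^ K * (2k * B)                    ≡⟨ lemma₁ 2k (c ^ K) B ⟩
      2k * (c ^ K * B)                    ≤⟨ *-monoʳ-≤ 2k (total-sum-map (bad L) (2 * G) (through x)
                                                λ e∈ → ≤-trans (≤-reflexive (bad-count L e∈))
                                                  (goodCount-∖-edge (extends m) L |L|≤m e∈)) ⟩
      2k * (length (through x) * (2 * G)) ≤⟨ *-monoʳ-≤ 2k (*-monoˡ-≤ (2 * G) (degree x)) ⟩
      2k * (Δ * (2 * G))                  ≡⟨ lemma₂ (suc K) Δ G ⟩
      4 * suc K * Δ * G                   ≤⟨ *-monoˡ-≤ G sparse ⟩
      c ^ K * G                           ∎)

  goodCount-positive : ∀ L → 0 < goodCount L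
  goodCount-positive [] = begin-strict
    0                      <⟨ m^n>0 c n ⟩
    c ^ n                  ≡⟨ *-identityʳ (c ^ n) ⟨
    c ^ n * 1              ≡⟨ total-const n 1 ⟨
    total n (λ _ → 1)      ≡⟨ total-cong n (λ χ → indicator-true (good? [] χ)
                                -- Edges are nonempty, so none fits inside the empty list and every
                                -- coloring is good.
                                (All.universal (λ { e (() ∷ _ , _) }) edges)) ⟨
    goodCount []           ∎
    where open ≤-Reasoning
  goodCount-positive (x ∷ L) = n≢0⇒n>0 λ G≡0 →
    contradiction (≤-trans (extends (suc (length L)) L ≤-refl x)
                    (≤-reflexive (trans (cong (2k *_) G≡0) (*-zeroʳ 2k))))
      (<⇒≱ (*-mono-≤ (≤-trans (s≤s z≤n) (m≤n+m (suc K) K)) (goodCount-positive L)))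

  -- A positive total cannot have all summands zero. No coloring is extracted, since the application
  -- is itself a refutation.
  ¬all-bad : ¬ (∀ χ → ¬ Good (allFin n) χ)
  ¬all-bad none = contradiction (goodCount-positive (allFin n)) (≤⇒≯ (≤-reflexive (begin
    goodCount (allFin n) ≡⟨ total-cong n (λ χ → indicator-false (good? (allFin n) χ) (none χ)) ⟩
    total n (λ _ → 0)    ≡⟨ total-const n 0 ⟩
    c ^ n * 0            ≡⟨ *-zeroʳ (c ^ n) ⟩
    0                    ∎)))
    where open ≡-Reasoning

-- Arithmetic progressions as hyperedges.

length-cartesianProductWith : ∀ {A B C : Set} (f : A → B → C) xs ys →
  length (cartesianProductWith f xs ys) ≡ length xs * length ys
length-cartesianProductWith f []       ys = refl
length-cartesianProductWith f (x ∷ xs) ys = trans (length-++ (map (f x) ys))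
  (cong₂ _+_ (length-map (f x) ys) (length-cartesianProductWith f xs ys))

module _ {n : ℕ} .{{_ : NonZero n}} where

  toℕ-mod : ∀ {x} → x < n → toℕ (x mod n) ≡ x
  toℕ-mod {x} x<n = trans (Fin.toℕ-fromℕ< (m%n<n x n)) (m<n⇒m%n≡m x<n)

  mod-injective : ∀ {x y} → x < n → y < n → x mod n ≡ y mod n → x ≡ y
  mod-injective x<n y<n eq = trans (sym (toℕ-mod x<n)) (trans (cong toℕ eq) (toℕ-mod y<n))

module _ (K n : ℕ) .{{_ : NonZero K}} .{{_ : NonZero n}} where

  -- The pair (a , d) encodes the progression a, a + (d + 1), …, a + K (d + 1) in {0, …, n - 1}.
  Fits : ℕ × ℕ → Set
  Fits (a , d) = a + K * suc d < n

  fits? : ∀ p → Dec (Fits p)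
  fits? (a , d) = a + K * suc d <? n

  -- Reduction modulo `n` only makes the function total; it changes nothing for terms of a
  -- progression that fits.
  term : ℕ × ℕ → ℕ → Fin n
  term (a , d) i = (a + i * suc d) mod n

  apEdge : ℕ × ℕ → Edge n
  apEdge p = term p 0 , applyUpTo (term p ∘ suc) K

  -- A progression that fits has K (d + 1) < n, hence d + 1 ≤ n / K, so these ranges of starts and
  -- gaps are exhaustive.
  apEdges : List (Edge n)
  apEdges = map apEdge (filter fits? (cartesianProduct (upTo n) (upTo (n / K))))

  -- Truncation in x ∸ j (d + 1) can only produce superfluous progressions.
  pairsThrough : Fin n → List (ℕ × ℕ)
  pairsThrough x =
    cartesianProductWith (λ j d → toℕ x ∸ j * suc d , d) (upTo (suc K)) (upTo (n / K))

  apEdgesThrough : Fin n → List (Edge n)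
  apEdgesThrough x = map apEdge (filter fits? (pairsThrough x))

  term-< : ∀ {a d i} → Fits (a , d) → i ≤ K → a + i * suc d < n
  term-< {a} {d} fits i≤K = ≤-<-trans (+-monoʳ-≤ a (*-monoˡ-≤ (suc d) i≤K)) fits

  toℕ-term : ∀ {a d i} → Fits (a , d) → i ≤ K → toℕ (term (a , d) i) ≡ a + i * suc d
  toℕ-term fits i≤K = toℕ-mod (term-< fits i≤K)

  -- If `x` is term number j, going back j gaps recovers the start, so the pair is among the
  -- candidates for `x`.
  apEdgesThrough-complete : ∀ {x e} → e ∈ apEdges → x ∈ vertices e → e ∈ apEdgesThrough x
  apEdgesThrough-complete e∈ x∈e
    with (a , d) , p∈ , refl ← ∈-map⁻ apEdge e∈
    with p∈′ , fits ← ∈-filter⁻ fits? {xs = cartesianProduct (upTo n) (upTo (n / K))} p∈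
    with _ , d∈ ← ∈-cartesianProduct⁻ (upTo n) (upTo (n / K)) p∈′
    -- The vertex list unfolds to `applyUpTo (term (a , d)) (suc K)`, so j = 0 covers the
    -- distinguished vertex as well.
    with j , s≤s j≤K , refl ← ∈-applyUpTo⁻ (term (a , d)) x∈e
    = ∈-map⁺ apEdge (∈-filter⁺ fits? (subst (_∈ pairsThrough (term (a , d) j)) (cong (_, d) start)
        (∈-cartesianProductWith⁺ (λ j′ d′ → toℕ (term (a , d) j) ∸ j′ * suc d′ , d′)
          (∈-upTo⁺ (s≤s j≤K)) d∈)) fits)
    where
    start : toℕ (term (a , d) j) ∸ j * suc d ≡ a
    start = trans (cong (_∸ j * suc d) (toℕ-term fits j≤K)) (m+n∸n≡m a (j * suc d))

  apEdge-simple : ∀ {p} → Fits p → Unique (vertices (apEdge p))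
  apEdge-simple {a , d} fits = Unique.applyUpTo⁺₁ (term (a , d)) (suc K)
    λ { {i} {j} i<j (s≤s j≤K) eq → <⇒≢ i<j (*-cancelʳ-≡ i j (suc d) (+-cancelˡ-≡ a _ _
          (mod-injective (term-< fits (≤-trans (<⇒≤ i<j) j≤K)) (term-< fits j≤K) eq))) }

  apEdgesThrough-simple : ∀ {x e} → e ∈ apEdgesThrough x → Unique (vertices e)
  apEdgesThrough-simple {x} e∈ with p , p∈ , refl ← ∈-map⁻ apEdge e∈ =
    apEdge-simple (proj₂ (∈-filter⁻ fits? {xs = pairsThrough x} p∈))

  apEdgesThrough-uniform : ∀ {x e} → e ∈ apEdgesThrough x → length (proj₂ e) ≡ K
  apEdgesThrough-uniform e∈ with p , _ , refl ← ∈-map⁻ apEdge e∈ =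
    length-applyUpTo (term p ∘ suc) K

  length-apEdgesThrough : ∀ x → length (apEdgesThrough x) ≤ suc K * (n / K)
  length-apEdgesThrough x = begin
    length (apEdgesThrough x)                  ≡⟨ length-map apEdge (filter fits? pairs) ⟩
    length (filter fits? pairs)                ≤⟨ length-filter fits? pairs ⟩
    length pairs                               ≡⟨ length-cartesianProductWith _ (upTo (suc K)) (upTo (n / K)) ⟩
    length (upTo (suc K)) * length (upTo (n / K))
      ≡⟨ cong₂ _*_ (length-upTo (suc K)) (length-upTo (n / K)) ⟩
    suc K * (n / K)                            ∎
    where
    open ≤-Reasoning
    pairs = pairsThrough x

  -- A forced monochromatic progression is an edge on which the coloring agrees, so no coloring
  -- would be good on all positions, against `¬all-bad`.
  sparse⇒avoidable : ∀ {c} .{{_ : NonZero c}} → 4 * suc K * (suc K * (n / K)) ≤ c ^ K →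
    ¬ EveryColoringContainsAP (suc K) c n
  sparse⇒avoidable {c} sparse forces = ¬all-bad apEdges apEdgesThrough apEdgesThrough-complete
    apEdgesThrough-simple apEdgesThrough-uniform length-apEdgesThrough sparse has-bad
    where
    has-bad : ∀ χ → ¬ All (λ e → ¬ (All (_∈ allFin n) (vertices e) × Agree {c = c} e χ)) apEdges
    has-bad χ good with forces (lookup χ)
    -- Stripping one successor from the start passes to positions counted from 0; stripping one from
    -- the gap matches its encoding.
    ... | suc a , suc d , _ , _ , P⊆[1⋯n] , mono =
      All.lookup good (∈-map⁺ apEdge (∈-filter⁺ fits? (∈-cartesianProduct⁺ (∈-upTo⁺ a<n) (∈-upTo⁺ d<D)) fits))
        (All.tabulate (λ {v} _ → ∈-allFin v) , All.tabulate agree)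
      where
      fits : Fits (a , d)
      -- The last term, number `K`, is at most `n`.
      fits = proj₂ (P⊆[1⋯n] (K , ≤-refl , refl))
      a<n : a < n
      a<n = ≤-<-trans (m≤m+n a (K * suc d)) fits
      d<D : d < n / K
      d<D = begin
        suc d           ≡⟨ m*n/n≡m (suc d) K ⟨
        suc d * K / K   ≤⟨ /-monoˡ-≤ K (≤-trans (≤-reflexive (*-comm (suc d) K))
                             (≤-trans (m≤n+m (K * suc d) a) (<⇒≤ fits))) ⟩
        n / K           ∎
        where open ≤-Reasoning
      inP : ∀ {i} → i ≤ K → Progression (suc K) (suc a) (suc d) (position (term (a , d) i))
      inP {i} i≤K = i , s≤s i≤K , cong suc (toℕ-term fits i≤K)
      agree : ∀ {z} → z ∈ applyUpTo (term (a , d) ∘ suc) K → lookup χ z ≡ lookup χ (term (a , d) 0)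
      agree z∈ with i , i<K , refl ← ∈-applyUpTo⁻ (term (a , d) ∘ suc) z∈ =
        mono _ _ (inP i<K) (inP z≤n)

-- The bound in natural numbers.

-- For k = m + 3 this is the bound multiplied by k². If it failed, `w` would be small enough for the
-- counting argument to avoid all progressions.
nat-bound : ∀ m c w .{{_ : NonZero c}} → 1 ≤ w → EveryColoringContainsAP (3 + m) c w →
  c ^ m * (2 + m) ≤ w * ((3 + m) * (3 + m))
-- The counting below uses c ≥ 2. With one color the power is 1, and 2 + m ≤ k² suffices.
nat-bound m 1 w 1≤w _ = begin
  1 ^ m * (2 + m)         ≡⟨ cong (_* (2 + m)) (^-zeroˡ m) ⟩
  1 * (2 + m)             ≤⟨ *-mono-≤ 1≤w (≤-trans (n≤1+n (2 + m)) (m≤m*n (3 + m) (3 + m))) ⟩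
  w * ((3 + m) * (3 + m)) ∎
  where open ≤-Reasoning
nat-bound m c@(suc (suc c′)) w 1≤w forces with c ^ m * (2 + m) ≤? w * ((3 + m) * (3 + m))
... | yes p = p
... | no ¬p = contradiction forces (sparse⇒avoidable K w {{_}} {{>-nonZero 1≤w}} sparse)
  where
  open ≤-Reasoning
  K k D : ℕ
  K = 2 + m
  k = 3 + m
  D = w / K
  k²D<cᵐ : k * (k * D) < c ^ m
  k²D<cᵐ = *-cancelʳ-< K _ _ (begin-strict
    k * (k * D) * K    ≡⟨ lemma k D K ⟩
    D * K * (k * k)    ≤⟨ *-monoˡ-≤ (k * k) (m/n*n≤m w K) ⟩
    w * (k * k)        <⟨ ≰⇒> ¬p ⟩
    c ^ m * K          ∎)
    where
    lemma : ∀ k D K → k * (k * D) * K ≡ D * K * (k * k)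
    lemma = solve-∀
  sparse : 4 * k * (k * D) ≤ c ^ K
  sparse = begin
    4 * k * (k * D)    ≡⟨ *-assoc 4 k (k * D) ⟩
    -- The factor 4 is absorbed by c², which is why c^(k-1) drops to c^(k-3).
    4 * (k * (k * D))  ≤⟨ *-mono-≤ (*-mono-≤ 2≤c 2≤c) (<⇒≤ k²D<cᵐ) ⟩
    c * c * c ^ m      ≡⟨ *-assoc c c (c ^ m) ⟩
    c ^ K              ∎
    where
    2≤c : 2 ≤ c
    2≤c = s≤s (s≤s z≤n)

-- Transfer to rational numbers.

toℚᵘ-/ : ∀ a b .{{_ : NonZero b}} → toℚᵘ (a ℚ./ b) ℚᵘ.≃ a ℚᵘ./ b
toℚᵘ-/ a (suc b) = ℚ.toℚᵘ-fromℚᵘ (mkℚᵘ a b)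

-- Unnormalised fractions multiply without reduction to lowest terms, so the claim becomes plain
-- cross-multiplication.
product-≤ : ∀ a b a′ b′ a″ b″ w .{{_ : NonZero b}} .{{_ : NonZero b′}} .{{_ : NonZero b″}} →
  a * a′ * a″ ≤ w * (b * b′ * b″) →
  ((+ a ℚ./ b) ℚ.* (+ a′ ℚ./ b′)) ℚ.* (+ a″ ℚ./ b″) ℚ.≤ ℕ→ℚ w
product-≤ a b@(suc _) a′ b′@(suc _) a″ b″@(suc _) w le = ℚ.toℚᵘ-cancel-≤ (begin
  toℚᵘ ((+ a ℚ./ b) ℚ.* (+ a′ ℚ./ b′) ℚ.* (+ a″ ℚ./ b″))
    ≃⟨ ℚ.toℚᵘ-homo-* ((+ a ℚ./ b) ℚ.* (+ a′ ℚ./ b′)) (+ a″ ℚ./ b″) ⟩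
  toℚᵘ ((+ a ℚ./ b) ℚ.* (+ a′ ℚ./ b′)) ℚᵘ.* toℚᵘ (+ a″ ℚ./ b″)
    ≃⟨ ℚᵘ.*-cong (ℚᵘ.≃-trans (ℚ.toℚᵘ-homo-* (+ a ℚ./ b) (+ a′ ℚ./ b′))
         (ℚᵘ.*-cong (toℚᵘ-/ (+ a) b) (toℚᵘ-/ (+ a′) b′))) (toℚᵘ-/ (+ a″) b″) ⟩
  (+ a ℚᵘ./ b) ℚᵘ.* (+ a′ ℚᵘ./ b′) ℚᵘ.* (+ a″ ℚᵘ./ b″)
    ≤⟨ *≤* (subst₂ ℤ._≤_
         (sym (trans (ℤ.*-identityʳ _)
           (trans (cong (ℤ._* + a″) (sym (ℤ.pos-* a a′))) (sym (ℤ.pos-* (a * a′) a″)))))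
         (ℤ.pos-* w (b * b′ * b″))
         (ℤ.+≤+ le)) ⟩
  + w ℚᵘ./ 1
    ≃⟨ toℚᵘ-/ (+ w) 1 ⟨
  toℚᵘ (ℕ→ℚ w) ∎)
  where open ℚᵘ.≤-Reasoning

lower-bound : ∀ (k c : ℕ) .{{_ : NonZero k}} .{{_ : NonZero c}} (w : ℕ) →
  IsVanDerWaerdenNumber k c w →
  ℕ→ℚ w ℚ.≥ mainTerm k c ℚ.* (((+ k) ℤ.- (+ 1)) ℚ./ k)
-- The factor (k-1)/k vanishes.
lower-bound 1 c w vdw =
  product-≤ 1 (c ^ 2) 1 1 0 1 w {{m^n≢0 c 2}} z≤n
-- The exponent is -1, so the left side is 1/(4c), below 1 ≤ `w`.
lower-bound 2 c w vdw =
  product-≤ 1 (c ^ 1) 1 2 1 2 w {{m^n≢0 c 1}} (*-mono-≤ (positive vdw)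
    (*-mono-≤ (*-mono-≤ (m^n>0 c 1) (s≤s {n = 1} z≤n)) (s≤s {n = 1} z≤n)))
  where open IsVanDerWaerdenNumber
lower-bound k@(suc (suc (suc m))) c w vdw =
  product-≤ (c ^ m) 1 1 k (2 + m) k w (begin
    c ^ m * 1 * (2 + m)    ≡⟨ cong (_* (2 + m)) (*-identityʳ (c ^ m)) ⟩
    c ^ m * (2 + m)          ≤⟨ nat-bound m c w (positive vdw) (forces vdw) ⟩
    w * (k * k)                ≡⟨ cong (λ t → w * (t * k)) (*-identityˡ k) ⟨
    w * (1 * k * k)          ∎)
  where
  open IsVanDerWaerdenNumber
  open ≤-Reasoning

-- The error term 1/k.

-- The value at 0 is a default; the identity for (k-1)/k concerns positive k.
reciprocal : ℕ → ℚ
reciprocal zero    = 0ℚ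
reciprocal (suc m) = + 1 ℚ./ suc m

reciprocal-nonNegative : ∀ k → 0ℚ ℚ.≤ reciprocal k
reciprocal-nonNegative zero    = ℚ.≤-refl
reciprocal-nonNegative (suc m) = ℚ.toℚᵘ-cancel-≤ (begin
  toℚᵘ 0ℚ              ≤⟨ *≤* (ℤ.+≤+ z≤n) ⟩
  mkℚᵘ (+ 1) m         ≃⟨ toℚᵘ-/ (+ 1) (suc m) ⟨
  toℚᵘ (+ 1 ℚ./ suc m) ∎)
  where open ℚᵘ.≤-Reasoning

reciprocal→0 : TendsToZero reciprocal
reciprocal→0 δ@(mkℚ (+ zero) _ _) (ℚ.*<* (ℤ.+<+ ()))
-- Here δ = (a+1)/(b+1), and k ≥ b + 2 gives 1/k < 1/(b+1) ≤ δ.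
reciprocal→0 δ@(mkℚ (+ suc a) b _) _ = suc (suc b) , small
  where
  open ℚᵘ.≤-Reasoning
  small : ∀ k → suc (suc b) ≤ k → ℚ.∣ reciprocal k ∣ ℚ.< δ
  small k@(suc m) (s≤s b<m) = subst (ℚ._< δ) (sym (ℚ.0≤p⇒∣p∣≡p (reciprocal-nonNegative k)))
    (ℚ.toℚᵘ-cancel-< (begin-strict
      toℚᵘ (+ 1 ℚ./ k)    ≃⟨ toℚᵘ-/ (+ 1) k ⟩
      mkℚᵘ (+ 1) m        <⟨ *<* (subst (ℤ._< + suc a ℤ.* + k) (sym (ℤ.*-identityˡ (+ suc b)))
                               (ℤ.+<+ (≤-trans (s≤s b<m) (m≤n*m k (suc a))))) ⟩
      toℚᵘ δ              ∎))
reciprocal→0 (mkℚ -[1+ _ ] _ _) (ℚ.*<* ())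

1-reciprocal : ∀ k .{{_ : NonZero k}} → ((+ k) ℤ.- (+ 1)) ℚ./ k ≡ 1ℚ ℚ.- reciprocal k
1-reciprocal k@(suc m) = ℚ.toℚᵘ-injective (begin-equality
  toℚᵘ (+ m ℚ./ k)                        ≃⟨ toℚᵘ-/ (+ m) k ⟩
  mkℚᵘ (+ m) m                            ≃⟨ *≡* (subst (λ t → + m ℤ.* + suc t ≡ + t ℤ.* + k)
                                               (sym (+-identityʳ m)) refl) ⟩
  toℚᵘ 1ℚ ℚᵘ.- mkℚᵘ (+ 1) m               ≃⟨ ℚᵘ.+-congʳ (toℚᵘ 1ℚ) (ℚᵘ.-‿cong (toℚᵘ-/ (+ 1) k)) ⟨
  toℚᵘ 1ℚ ℚᵘ.- toℚᵘ (reciprocal k)        ≃⟨ ℚᵘ.+-congʳ (toℚᵘ 1ℚ) (ℚ.toℚᵘ-homo‿- (reciprocal k)) ⟨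
  toℚᵘ 1ℚ ℚᵘ.+ toℚᵘ (ℚ.- reciprocal k)    ≃⟨ ℚ.toℚᵘ-homo-+ 1ℚ (ℚ.- reciprocal k) ⟨
  toℚᵘ (1ℚ ℚ.- reciprocal k)              ∎)
  where open ℚᵘ.≤-Reasoning

theorem1 : (∀ (k c : ℕ) .{{_ : NonZero k}} .{{_ : NonZero c}} (w : ℕ) →
    IsVanDerWaerdenNumber k c w →
    ℕ→ℚ w ℚ.≥ mainTerm k c ℚ.* (((+ k) ℤ.- (+ 1)) ℚ./ k))
    × (∃[ ε ] (TendsToZero ε
    × (∀ (k c : ℕ) .{{_ : NonZero k}} .{{_ : NonZero c}} →
    mainTerm k c ℚ.* (((+ k) ℤ.- (+ 1)) ℚ./ k)
    ≡ mainTerm k c ℚ.* (1ℚ ℚ.- ε k))))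
theorem1 = lower-bound , reciprocal , reciprocal→0 ,
  λ k c → cong (mainTerm k c ℚ.*_) (1-reciprocal k)
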